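{- Let $G$ be a labeled $r$-regular bipartite graph with $2m$ vertices, and let $\{p_1,\dots,p_r\}\subset S_m$ be a permutation representation of $G$. Then the Automorphism Group of $G$ (in the sense given in the context) can be enumerated by enumerating all distinct labeled $r$-regular bipartite graphs with $2m$ vertices generated by combinations of permutations on depth and permutations on labels applied to the permutation representation of $G$; that is, the Automorphism Group of $G$ equals the set of labeled graphs obtained in this way.
   Context: A labeled $r$-regular bipartite graph with $2m$ vertices is a simple graph with vertex set the disjoint union of $CN=\{CN_1,\dots,CN_m\}$ and $VN=\{VN_1,\dots,VN_m\}$ and edge set $E\subset CN\times VN$ such that every vertex has degree $r$. Its bi-adjacency matrix is the $m\times m$ $0/1$ matrix with $(i,j)$ entry $1$ iff $(CN_i,VN_j)\in E$. Two such graphs are isomorphic if one bi-adjacency matrix can be transformed into the other by row exchanges and column exchanges. In this paper's terminology, the Automorphism Group of $G$ is the set of all labeled $r$-regular bipartite graphs with $2m$ vertices (on the same labeled vertex sets) that are isomorphic to $G$. Permutations $p_1,\dots,p_r\in S_m$ are compatible if $p_i(j)\neq p_k(j)$ for all $i\ne k$ and all $j$; they form a permutation representation of $G$ if they are compatible and the edges of $G$ are exactly the pairs $(CN_j,VN_{p_i(j)})$, $1\le i\le r$, $1\le j\le m$. The index $j$ is called the depth and the value $p_i(j)$ the label. A permutation on depth by $\sigma\in S_m$ replaces every $p_i$ by $p_i\circ\sigma$ (the same $\sigma$ for all $i$); a permutation on labels by $\tau\in S_m$ replaces every $p_i$ by $\tau\circ p_i$ (the same $\tau$ for all $i$). -}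

module Defs where

open import Data.Fin.Base using (Fin)
open import Data.Fin.Permutation using (Permutation′; _⟨$⟩ʳ_; _∘ₚ_; transpose)
open import Data.Fin.Subset using (Subset; _∈_; ∣_∣)
open import Data.Nat.Base using (ℕ)
open import Data.Product.Base using (∃-syntax; _×_)
open import Data.Vec.Base as Vec using (Vec; lookup; map; tabulate)
open import Function.Base using (_∘_)
open import Function.Bundles using (_⇔_; Injection)
open import Function.Properties.Inverse using (↔⇒↣)
open import Level using (0ℓ)
open import Relation.Binary.Construct.Closure.ReflexiveTransitive using (Star)
open import Relation.Binary.PropositionalEquality.Core using (_≡_; _≢_)
open import Relation.Unary using (Pred)

private
  variable
    r m : ℕ

-- A labeled bipartite graph on CN = VN = Fin m, given by its bi-adjacency
-- matrix: row j is the set of the neighbours in VN of the vertex CN_j.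
-- As a first-order datum, two labeled graphs are equal iff they are _≡_.
BipartiteGraph : ℕ → Set
BipartiteGraph m = Vec (Subset m) m

Edge : BipartiteGraph m → Fin m → Fin m → Set
Edge G j k = k ∈ lookup G j

IsRegular : ℕ → BipartiteGraph m → Set
IsRegular r G = (∀ j → ∣ lookup G j ∣ ≡ r) × (∀ k → ∣ lookup (Vec.transpose G) k ∣ ≡ r)

exchangeRows : Fin m → Fin m → BipartiteGraph m → BipartiteGraph m
exchangeRows i j G = tabulate (λ k → lookup G (transpose i j ⟨$⟩ʳ k))

exchangeColumns : Fin m → Fin m → BipartiteGraph m → BipartiteGraph m
exchangeColumns i j = map (λ row → tabulate (λ k → lookup row (transpose i j ⟨$⟩ʳ k)))

data Exchange (G : BipartiteGraph m) : BipartiteGraph m → Set where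
  rows    : ∀ i j → Exchange G (exchangeRows i j G)
  columns : ∀ i j → Exchange G (exchangeColumns i j G)

Isomorphic : BipartiteGraph m → BipartiteGraph m → Set
Isomorphic = Star Exchange

-- Not the group of self-isomorphisms: the set of all labeled r-regular graphs
-- on the same vertex sets that are isomorphic to G.
AutomorphismGroup : ℕ → BipartiteGraph m → Pred (BipartiteGraph m) 0ℓ
AutomorphismGroup r G H = IsRegular r H × Isomorphic G H

record CompatiblePermutations (r m : ℕ) : Set where
  field
    perm       : Fin r → Permutation′ m
    compatible : ∀ {i k} → i ≢ k → ∀ j → perm i ⟨$⟩ʳ j ≢ perm k ⟨$⟩ʳ j

open CompatiblePermutations public

_IsRepresentationOf_ : CompatiblePermutations r m → BipartiteGraph m → Set
p IsRepresentationOf G = ∀ j k → Edge G j k ⇔ (∃[ i ] perm p i ⟨$⟩ʳ j ≡ k)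

-- _∘ₚ_ composes in diagrammatic order: the new permutations are p_i ∘ σ.
permuteDepth : Permutation′ m → CompatiblePermutations r m → CompatiblePermutations r m
permuteDepth σ p = record
  { perm       = λ i → σ ∘ₚ perm p i
  ; compatible = λ i≢k j → compatible p i≢k (σ ⟨$⟩ʳ j)
  }

-- The new permutations are τ ∘ p_i.
permuteLabels : Permutation′ m → CompatiblePermutations r m → CompatiblePermutations r m
permuteLabels τ p = record
  { perm       = λ i → perm p i ∘ₚ τ
  ; compatible = λ i≢k j → compatible p i≢k j ∘ Injection.injective (↔⇒↣ τ)
  }

data Step (p : CompatiblePermutations r m) : CompatiblePermutations r m → Set where
  onDepth  : ∀ σ → Step p (permuteDepth σ p)
  onLabels : ∀ τ → Step p (permuteLabels τ p)

-- H ranges over all bipartite graphs: regularity is not imposed here.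
GeneratedGraphs : CompatiblePermutations r m → Pred (BipartiteGraph m) 0ℓ
GeneratedGraphs p H = ∃[ q ] Star Step p q × q IsRepresentationOf H

{-# OPTIONS --safe #-}

-- Exchanging two rows composes every p_i with a transposition of depths, and
-- exchanging two columns composes every p_i with a transposition of labels;
-- conversely every permutation is a product of transpositions. Hence "moving
-- the permutations" and "moving the graph they represent" can be done in step,
-- in both directions, and a representation determines its graph.

module Submission where

open import Defs
open import Data.Nat.Base using (ℕ)
open import Relation.Unary using (_≐_)

open import Data.Bool.Base using (true; false; if_then_else_)
open import Data.Fin.Base using (Fin; zero; suc)
open import Data.Fin.Permutation as Perm
  using (Permutation′; _⟨$⟩ʳ_; _⟨$⟩ˡ_; _∘ₚ_; flip; inverseˡ; inverseʳ)
open import Data.Fin.Permutation.Transposition.List using (eval; decompose; eval-decompose)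
open import Data.Fin.Subset using (Subset; _∈_; _⊆_; ∣_∣)
open import Data.Fin.Subset.Properties using (⊆-antisym)
open import Data.List.Base using ([]; _∷_)
open import Data.Nat.Properties using (+-0-commutativeMonoid)
open import Algebra.Properties.CommutativeMonoid.Sum +-0-commutativeMonoid
  using (sum; sum-permute; sum-cong-≗)
open import Data.Product.Base using (∃-syntax; _,_)
open import Data.Vec.Base using (Vec; []; _∷_; lookup; map; tabulate; transpose; _⊛_; replicate)
open import Data.Vec.Properties
  using ([]=⇒lookup; lookup⇒[]=; lookup-map; lookup∘tabulate; tabulate∘lookup; tabulate-cong
        ; map-cong; map-id; map-∘; lookup-⊛; lookup-replicate)
open import Function.Base using (_∘_)
open import Function.Bundles using (_⇔_; mk⇔; Equivalence)
open import Function.Properties.Equivalence using () renaming (trans to ⇔-trans)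
open import Relation.Binary.Construct.Closure.ReflexiveTransitive using (Star; ε; _◅_; _◅◅_)
open import Relation.Binary.PropositionalEquality

private
  variable
    A : Set
    r m n : ℕ
    G H : BipartiteGraph m
    p q : CompatiblePermutations r m

lookup-ext : {xs ys : Vec A n} → lookup xs ≗ lookup ys → xs ≡ ys
lookup-ext {xs = xs} {ys} eq =
  trans (sym (tabulate∘lookup xs)) (trans (tabulate-cong eq) (tabulate∘lookup ys))

-- For a transposition this unfolds to the body of `exchangeRows`, and under `map` to that of
-- `exchangeColumns`, so single exchanges need no transport.
rearrange : Permutation′ n → Vec A n → Vec A n
rearrange σ xs = tabulate (λ k → lookup xs (σ ⟨$⟩ʳ k))

lookup-rearrange : ∀ (σ : Permutation′ n) (xs : Vec A n) k →
  lookup (rearrange σ xs) k ≡ lookup xs (σ ⟨$⟩ʳ k)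
lookup-rearrange σ xs = lookup∘tabulate _

rearrange-cong : (σ τ : Permutation′ n) → σ Perm.≈ τ →
  (xs : Vec A n) → rearrange σ xs ≡ rearrange τ xs
rearrange-cong σ τ σ≈τ xs = tabulate-cong (cong (lookup xs) ∘ σ≈τ)

-- Reading through a permutation is contravariant: the outer rearrangement acts on the index first,
-- hence stands first in the diagrammatic `_∘ₚ_`.
rearrange-∘ : ∀ (σ τ : Permutation′ n) (xs : Vec A n) →
  rearrange σ (rearrange τ xs) ≡ rearrange (σ ∘ₚ τ) xs
rearrange-∘ σ τ xs = tabulate-cong (lookup-rearrange τ xs ∘ (σ ⟨$⟩ʳ_))

∈-rearrange : ∀ (σ : Permutation′ n) (S : Subset n) k →
  k ∈ rearrange σ S ⇔ (σ ⟨$⟩ʳ k) ∈ S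
∈-rearrange σ S k = mk⇔
  (λ k∈ → lookup⇒[]= _ S (trans (sym (lookup-rearrange σ S k)) ([]=⇒lookup k∈)))
  (λ σk∈ → lookup⇒[]= k _ (trans (lookup-rearrange σ S k) ([]=⇒lookup σk∈)))

-- Writing the cardinality as a sum of indicators makes `sum-permute` applicable to vertex degrees.
∣S∣≡sum : (S : Subset n) → ∣ S ∣ ≡ sum (λ k → if lookup S k then 1 else 0)
∣S∣≡sum []          = refl
∣S∣≡sum (true  ∷ S) = cong ℕ.suc (∣S∣≡sum S)
∣S∣≡sum (false ∷ S) = ∣S∣≡sum S

∣rearrange∣ : (σ : Permutation′ n) (S : Subset n) → ∣ rearrange σ S ∣ ≡ ∣ S ∣
∣rearrange∣ σ S = begin
  ∣ rearrange σ S ∣                              ≡⟨ ∣S∣≡sum (rearrange σ S) ⟩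
  sum (indicator ∘ lookup (rearrange σ S))       ≡⟨ sum-cong-≗ (cong indicator ∘ lookup-rearrange σ S) ⟩
  sum (indicator ∘ lookup S ∘ (σ ⟨$⟩ʳ_))         ≡⟨ sum-permute (indicator ∘ lookup S) σ ⟨
  sum (indicator ∘ lookup S)                     ≡⟨ ∣S∣≡sum S ⟨
  ∣ S ∣                                          ∎
  where
  open ≡-Reasoning
  indicator = λ b → if b then 1 else 0

lookup-transpose-∷ : ∀ (xs : Vec A n) (xss : Vec (Vec A n) m) k →
  lookup (transpose (xs ∷ xss)) k ≡ lookup xs k ∷ lookup (transpose xss) k
lookup-transpose-∷ {A = A} {n} {m} xs xss k = begin
  lookup (replicate n cons ⊛ xs ⊛ transpose xss) k                        ≡⟨ lookup-⊛ k (replicate n cons ⊛ xs) (transpose xss) ⟩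
  lookup (replicate n cons ⊛ xs) k (lookup (transpose xss) k)             ≡⟨ cong (λ f → f (lookup (transpose xss) k)) (lookup-⊛ k (replicate n cons) xs) ⟩
  lookup (replicate n cons) k (lookup xs k) (lookup (transpose xss) k)    ≡⟨ cong (λ f → f (lookup xs k) (lookup (transpose xss) k)) (lookup-replicate k cons) ⟩
  lookup xs k ∷ lookup (transpose xss) k                                  ∎
  where
  open ≡-Reasoning
  cons : A → Vec A m → Vec A (ℕ.suc m)
  cons = _∷_

lookup-transpose : ∀ (xss : Vec (Vec A n) m) j k →
  lookup (lookup (transpose xss) k) j ≡ lookup (lookup xss j) k
lookup-transpose (xs ∷ xss) zero    k = cong (λ v → lookup v zero) (lookup-transpose-∷ xs xss k)
lookup-transpose (xs ∷ xss) (suc j) k =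
  trans (cong (λ v → lookup v (suc j)) (lookup-transpose-∷ xs xss k)) (lookup-transpose xss j k)

permuteRows : Permutation′ m → BipartiteGraph m → BipartiteGraph m
permuteRows σ = rearrange σ

permuteColumns : Permutation′ m → BipartiteGraph m → BipartiteGraph m
permuteColumns σ = map (rearrange σ)

lookup-permuteColumns : ∀ (σ : Permutation′ m) G j k →
  lookup (lookup (permuteColumns σ G) j) k ≡ lookup (lookup G j) (σ ⟨$⟩ʳ k)
lookup-permuteColumns σ G j k =
  trans (cong (λ row → lookup row k) (lookup-map j (rearrange σ) G))
        (lookup-rearrange σ (lookup G j) k)

-- Column degrees are read off the transpose, where moving rows only shuffles the entries inside
-- each column.
transpose-permuteRows : ∀ (σ : Permutation′ m) G k →
  lookup (transpose (permuteRows σ G)) k ≡ rearrange σ (lookup (transpose G) k)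
transpose-permuteRows σ G k = lookup-ext λ j → begin
  lookup (lookup (transpose (permuteRows σ G)) k) j   ≡⟨ lookup-transpose (permuteRows σ G) j k ⟩
  lookup (lookup (permuteRows σ G) j) k               ≡⟨ cong (λ row → lookup row k) (lookup-rearrange σ G j) ⟩
  lookup (lookup G (σ ⟨$⟩ʳ j)) k                      ≡⟨ lookup-transpose G (σ ⟨$⟩ʳ j) k ⟨
  lookup (lookup (transpose G) k) (σ ⟨$⟩ʳ j)          ≡⟨ lookup-rearrange σ (lookup (transpose G) k) j ⟨
  lookup (rearrange σ (lookup (transpose G) k)) j     ∎
  where open ≡-Reasoning

transpose-permuteColumns : ∀ (σ : Permutation′ m) G k →
  lookup (transpose (permuteColumns σ G)) k ≡ lookup (transpose G) (σ ⟨$⟩ʳ k)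
transpose-permuteColumns σ G k = lookup-ext λ j → begin
  lookup (lookup (transpose (permuteColumns σ G)) k) j  ≡⟨ lookup-transpose (permuteColumns σ G) j k ⟩
  lookup (lookup (permuteColumns σ G) j) k              ≡⟨ lookup-permuteColumns σ G j k ⟩
  lookup (lookup G j) (σ ⟨$⟩ʳ k)                        ≡⟨ lookup-transpose G j (σ ⟨$⟩ʳ k) ⟨
  lookup (lookup (transpose G) (σ ⟨$⟩ʳ k)) j            ∎
  where open ≡-Reasoning

-- Rows are only reordered, and each column keeps its number of ones.
permuteRows-regular : (G : BipartiteGraph m) (σ : Permutation′ m) →
  IsRegular r G → IsRegular r (permuteRows σ G)
permuteRows-regular G σ (rowDegree , columnDegree) =
  (λ j → trans (cong ∣_∣ (lookup-rearrange σ G j)) (rowDegree (σ ⟨$⟩ʳ j))) ,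
  (λ k → trans (cong ∣_∣ (transpose-permuteRows σ G k))
               (trans (∣rearrange∣ σ (lookup (transpose G) k)) (columnDegree k)))

permuteColumns-regular : (G : BipartiteGraph m) (σ : Permutation′ m) →
  IsRegular r G → IsRegular r (permuteColumns σ G)
permuteColumns-regular G σ (rowDegree , columnDegree) =
  (λ j → trans (cong ∣_∣ (lookup-map j (rearrange σ) G))
               (trans (∣rearrange∣ σ (lookup G j)) (rowDegree j))) ,
  (λ k → trans (cong ∣_∣ (transpose-permuteColumns σ G k)) (columnDegree (σ ⟨$⟩ʳ k)))

permuteRows-isomorphic : (σ : Permutation′ m) (G : BipartiteGraph m) → Isomorphic G (permuteRows σ G)
permuteRows-isomorphic σ G =
  subst (Isomorphic G) (rearrange-cong (eval (decompose σ)) σ (eval-decompose σ) G) (go (decompose σ))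
  where
  go : ∀ ts → Isomorphic G (permuteRows (eval ts) G)
  -- The empty product is the identity, and rearranging by it returns `G` only propositionally.
  go []             = subst (Isomorphic G) (sym (tabulate∘lookup G)) ε
  go ((i , j) ∷ ts) = subst (Isomorphic G) (rearrange-∘ (Perm.transpose i j) (eval ts) G)
    -- By contravariance the head transposition is the outermost rearrangement, so its exchange
    -- comes last in the path.
    (go ts ◅◅ rows i j ◅ ε)

permuteColumns-isomorphic : (σ : Permutation′ m) (G : BipartiteGraph m) →
  Isomorphic G (permuteColumns σ G)
permuteColumns-isomorphic σ G =
  subst (Isomorphic G) (map-cong (rearrange-cong (eval (decompose σ)) σ (eval-decompose σ)) G) (go (decompose σ))
  where
  go : ∀ ts → Isomorphic G (permuteColumns (eval ts) G)
  go []             = subst (Isomorphic G) (sym (trans (map-cong tabulate∘lookup G) (map-id G))) ε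
  go ((i , j) ∷ ts) = subst (Isomorphic G)
    (trans (sym (map-∘ (rearrange t) (rearrange (eval ts)) G))
           (map-cong (rearrange-∘ t (eval ts)) G))
    (go ts ◅◅ columns i j ◅ ε)
    where t = Perm.transpose i j

-- At depth `j` both the new graph and the new permutations are the old ones at depth `σ j`, so this
-- is an instance of the given equivalence.
permuteDepth-represents : (p : CompatiblePermutations r m) (G : BipartiteGraph m) (σ : Permutation′ m) →
  p IsRepresentationOf G →
  permuteDepth σ p IsRepresentationOf permuteRows σ G
permuteDepth-represents p G σ rep j k =
  subst (λ row → k ∈ row ⇔ (∃[ i ] perm p i ⟨$⟩ʳ (σ ⟨$⟩ʳ j) ≡ k))
        (sym (lookup-rearrange σ G j)) (rep (σ ⟨$⟩ʳ j) k)

-- Labels move forward along τ, so the matrix columns are read through τ⁻¹.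
permuteLabels-represents : (p : CompatiblePermutations r m) (G : BipartiteGraph m) (τ : Permutation′ m) →
  p IsRepresentationOf G →
  permuteLabels τ p IsRepresentationOf permuteColumns (flip τ) G
permuteLabels-represents p G τ rep j k =
  subst (λ row → k ∈ row ⇔ (∃[ i ] τ ⟨$⟩ʳ (perm p i ⟨$⟩ʳ j) ≡ k))
        (sym (lookup-map j (rearrange (flip τ)) G))
        (⇔-trans (∈-rearrange (flip τ) (lookup G j) k)
        (⇔-trans (rep j (τ ⟨$⟩ˡ k))
                 (mk⇔ (λ (i , eq) → i , trans (cong (τ ⟨$⟩ʳ_) eq) (inverseʳ τ))
                      (λ (i , eq) → i , trans (sym (inverseˡ τ)) (cong (τ ⟨$⟩ˡ_) eq)))))

-- The representation fixes the membership of every row, and subsets are extensional. This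
-- identifies the graph reached at the end of a sequence of steps.
represented-unique : (p : CompatiblePermutations r m) (G H : BipartiteGraph m) →
  p IsRepresentationOf G → p IsRepresentationOf H → G ≡ H
represented-unique p G H repG repH =
  lookup-ext λ j → ⊆-antisym (edges⊆ G H repG repH j) (edges⊆ H G repH repG j)
  where
  edges⊆ : ∀ G H → p IsRepresentationOf G → p IsRepresentationOf H → ∀ j → lookup G j ⊆ lookup H j
  edges⊆ G H repG repH j {k} = Equivalence.from (repH j k) ∘ Equivalence.to (repG j k)

-- Induction on the exchange path: `p` moves along with the graph, so it always represents the
-- current one.
isomorphic⇒generated : (p : CompatiblePermutations r m) → p IsRepresentationOf G →
  Isomorphic G H → GeneratedGraphs p H
isomorphic⇒generated p rep ε = p , ε , rep
isomorphic⇒generated {G = G} p rep (rows i j ◅ iso) =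
  let t = Perm.transpose i j
      q , steps , repH = isomorphic⇒generated (permuteDepth t p) (permuteDepth-represents p G t rep) iso
  in q , onDepth t ◅ steps , repH
isomorphic⇒generated {G = G} p rep (columns i j ◅ iso) =
  -- Relabelling by `τ` reads columns through `flip τ`. Starting from the inverse, the double `flip`
  -- computes back to `t`, giving exactly the column exchange.
  let t⁻¹ = flip (Perm.transpose i j)
      q , steps , repH = isomorphic⇒generated (permuteLabels t⁻¹ p) (permuteLabels-represents p G t⁻¹ rep) iso
  in q , onLabels t⁻¹ ◅ steps , repH

-- Induction on the steps with `G` varying: the graph follows the permutations, carrying its
-- regularity to the end of the path.
generated⇒automorphic : ∀ G → IsRegular r G → p IsRepresentationOf G →
  Star Step p q → q IsRepresentationOf H → AutomorphismGroup r G H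
generated⇒automorphic {r} {p = p} {H = H} G reg repG ε repH =
  -- With no steps left, `p` represents both `G` and `H`, so they coincide.
  subst (AutomorphismGroup r G) (represented-unique p G H repG repH) (reg , ε)
generated⇒automorphic {p = p} G reg repG (onDepth σ ◅ steps) repH =
  let regH , iso = generated⇒automorphic (permuteRows σ G) (permuteRows-regular G σ reg)
                     (permuteDepth-represents p G σ repG) steps repH
  in regH , permuteRows-isomorphic σ G ◅◅ iso
generated⇒automorphic {p = p} G reg repG (onLabels τ ◅ steps) repH =
  let regH , iso = generated⇒automorphic (permuteColumns (flip τ) G) (permuteColumns-regular G (flip τ) reg)
                     (permuteLabels-represents p G τ repG) steps repH
  in regH , permuteColumns-isomorphic (flip τ) G ◅◅ iso

theorem53 : (r m : ℕ) (G : BipartiteGraph m) → IsRegular r G →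
    (p : CompatiblePermutations r m) → p IsRepresentationOf G →
    AutomorphismGroup r G ≐ GeneratedGraphs p
theorem53 r m G reg p rep =
  (λ (_ , iso) → isomorphic⇒generated p rep iso) ,
  (λ (_ , steps , repH) → generated⇒automorphic G reg rep steps repH)
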